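{- Let $a,b,c$ be complex numbers and let $(g(x),xg(x))$ be the Bell pseudo-involution whose $B$-sequence has generating function $$B(x)=\frac{a-cx}{1+bx}.$$ Then $g(x)$ can be expressed as the continued fraction $$g(x)=\cfrac{1}{1-ax-bx^2+\cfrac{x^2(b+cx)}{1-ax-bx^2+\cfrac{x^2(b+cx)}{1-ax-bx^2+\cdots}}}.$$
   Context: All power series are formal, with complex coefficients. The infinite continued fraction is the limit of its finite truncations in the $x$-adic topology on formal power series. Riordan arrays: for $g(x)=1+g_1x+\cdots$ and $f(x)=f_1x+f_2x^2+\cdots$ with $f_1\neq 0$, the Riordan array $(g(x),f(x))$ is the infinite lower triangular matrix with entries $t_{n,k}=[x^n]\,g(x)f(x)^k$, $n,k\ge 0$. The product of Riordan arrays is $(g,f)\cdot(u,v)=(g(x)u(f(x)),v(f(x)))$, and the identity is $(1,x)$. A Bell array is a Riordan array of the form $(g(x),xg(x))$ with $g(0)=1$. It is a Bell pseudo-involution if $(g(x),-xg(x))^2=(1,x)$. $B$-sequence: the $B$-sequence of a Bell pseudo-involution $(g(x),xg(x))$ with entries $t_{n,k}$ is the sequence $b_0,b_1,b_2,\ldots$ such that, for all $n,k\ge 0$, $$t_{n+1,k}=t_{n,k-1}+\sum_{j\ge 0} b_j\, t_{n-j,k+j},$$ where $t_{n,-1}=0$ and $t_{m,l}=0$ whenever $m<0$ or $l>m$. Its generating function is $B(x)=\sum_{j\ge0} b_jx^j$. -}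

module Defs where

open import Algebra.Bundles using (CommutativeRing)
import Algebra.Properties.CommutativeSemigroup as CommutativeSemigroupProperties
import Algebra.Properties.Group as GroupProperties
import Algebra.Properties.Ring as RingProperties
import Algebra.Solver.Ring.NaturalCoefficients.Default as NaturalCoefficientsSolver
open import Data.Fin.Base using (toℕ)
open import Data.Nat.Base as ℕ using (ℕ; zero; suc)
import Data.Nat.Properties as ℕ
open import Data.Product.Base using (Σ; ∃; _×_; _,_; proj₁; proj₂)
open import Data.Rational.Base as ℚ using (ℚ; 0ℚ; 1ℚ; ½; ∣_∣)
import Data.Rational.Properties as ℚ
open import Level using (0ℓ)
import Relation.Binary.Reasoning.Setoid as ≈-Reasoning
open import Relation.Binary.PropositionalEquality as ≡ using (_≡_; cong; subst)
open import Relation.Nullary.Negation using (¬_)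

-- The real numbers are the Cauchy sequences of rationals, with equality
-- "the difference tends to 0"; every Cauchy sequence carries a modulus.

module Real where

  infix 4 _~_ _≈_

  -- On Cauchy sequences, x ~ y says that x n - y n tends to 0;
  -- x ~ x says that x is Cauchy.
  _~_ : (ℕ → ℚ) → (ℕ → ℚ) → Set
  x ~ y = ∀ ε → 0ℚ ℚ.< ε →
    Σ ℕ λ N → ∀ m n → N ℕ.≤ m → N ℕ.≤ n → ∣ x m ℚ.- y n ∣ ℚ.< ε

  record ℝ : Set where
    field
      seq    : ℕ → ℚ
      cauchy : seq ~ seq

  open ℝ public

  _≈_ : ℝ → ℝ → Set
  x ≈ y = seq x ~ seq y

  private
    open GroupProperties ℚ.+-0-group
      using (⁻¹-anti-homo-//; \\-leftDividesʳ; //-rightDividesˡ)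
    open CommutativeSemigroupProperties (CommutativeRing.+-commutativeSemigroup ℚ.+-*-commutativeRing)
      using (interchange)

    half : ℚ → ℚ
    half ε = ½ ℚ.* ε

    half>0 : ∀ ε → 0ℚ ℚ.< ε → 0ℚ ℚ.< half ε
    half>0 ε p = subst (ℚ._< half ε) (ℚ.*-zeroʳ ½) (ℚ.*-monoʳ-<-pos ½ p)

    half+half : ∀ ε → half ε ℚ.+ half ε ≡ ε
    half+half ε = ≡.trans (≡.sym (ℚ.*-distribʳ-+ ε ½ ½)) (ℚ.*-identityˡ ε)

    ∣+∣< : ∀ {p q ε} → ∣ p ∣ ℚ.< half ε → ∣ q ∣ ℚ.< half ε → ∣ p ℚ.+ q ∣ ℚ.< ε
    ∣+∣< {p} {q} {ε} p< q< = subst (∣ p ℚ.+ q ∣ ℚ.<_) (half+half ε)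
      (ℚ.≤-<-trans (ℚ.∣p+q∣≤∣p∣+∣q∣ p q) (ℚ.+-mono-< p< q<))

    ⊔ˡ : ∀ {M N n} → M ℕ.⊔ N ℕ.≤ n → M ℕ.≤ n
    ⊔ˡ {M} {N} = ℕ.≤-trans (ℕ.m≤m⊔n M N)

    ⊔ʳ : ∀ {M N n} → M ℕ.⊔ N ℕ.≤ n → N ℕ.≤ n
    ⊔ʳ {M} {N} = ℕ.≤-trans (ℕ.m≤n⊔m M N)

    split : ∀ p q r → p ℚ.- r ≡ (p ℚ.- q) ℚ.+ (q ℚ.- r)
    split p q r = ≡.sym (≡.trans (ℚ.+-assoc p (ℚ.- q) (q ℚ.- r))
      (cong (p ℚ.+_) (\\-leftDividesʳ q (ℚ.- r))))

    split-+ : ∀ p q r s → (p ℚ.+ q) ℚ.- (r ℚ.+ s) ≡ (p ℚ.- r) ℚ.+ (q ℚ.- s)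
    split-+ p q r s = ≡.trans (cong ((p ℚ.+ q) ℚ.+_) (ℚ.neg-distrib-+ r s))
      (interchange p q (ℚ.- r) (ℚ.- s))

    distrib-minus : ∀ p q r → p ℚ.* (q ℚ.- r) ≡ p ℚ.* q ℚ.- p ℚ.* r
    distrib-minus p q r = ≡.trans (ℚ.*-distribˡ-+ p q (ℚ.- r))
      (cong (p ℚ.* q ℚ.+_) (≡.sym (ℚ.neg-distribʳ-* p r)))

    split-* : ∀ p q r s →
      p ℚ.* q ℚ.- r ℚ.* s ≡ p ℚ.* (q ℚ.- s) ℚ.+ s ℚ.* (p ℚ.- r)
    split-* p q r s = ≡.trans (split (p ℚ.* q) (p ℚ.* s) (r ℚ.* s))
      (≡.cong₂ ℚ._+_ (≡.sym (distrib-minus p q s))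
        (≡.trans (≡.cong₂ ℚ._-_ (ℚ.*-comm p s) (ℚ.*-comm r s)) (≡.sym (distrib-minus s p r))))

  abstract
    ~-sym : ∀ {x y} → x ~ y → y ~ x
    ~-sym {x} {y} x~y ε ε>0 with N , h ← x~y ε ε>0 = N , λ m n N≤m N≤n →
      subst (ℚ._< ε)
        (≡.trans (≡.sym (ℚ.∣-p∣≡∣p∣ (x n ℚ.- y m))) (cong ∣_∣ (⁻¹-anti-homo-// (x n) (y m))))
        (h n m N≤n N≤m)

    ~-trans : ∀ {x y z} → x ~ y → y ~ z → x ~ z
    ~-trans {x} {y} {z} x~y y~z ε ε>0
      with M , h ← x~y (half ε) (half>0 ε ε>0) | N , k ← y~z (half ε) (half>0 ε ε>0) =
      M ℕ.⊔ N , λ m n ≤m ≤n →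
        subst (λ t → ∣ t ∣ ℚ.< ε) (≡.sym (split (x m) (y (M ℕ.⊔ N)) (z n)))
          (∣+∣< (h m (M ℕ.⊔ N) (⊔ˡ ≤m) (ℕ.m≤m⊔n M N))
                (k (M ℕ.⊔ N) n (ℕ.m≤n⊔m M N) (⊔ʳ {M} ≤n)))

    ~-resp : ∀ {x y x′} → (∀ n → x n ≡ x′ n) → x ~ y → x′ ~ y
    ~-resp {y = y} eq x~y ε ε>0 with N , h ← x~y ε ε>0 = N , λ m n N≤m N≤n →
      subst (λ t → ∣ t ℚ.- y n ∣ ℚ.< ε) (eq m) (h m n N≤m N≤n)

    ~-const : ∀ q → (λ _ → q) ~ (λ _ → q)
    ~-const q ε ε>0 = 0 , λ _ _ _ _ →
      subst (λ t → ∣ t ∣ ℚ.< ε) (≡.sym (ℚ.+-inverseʳ q)) ε>0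

    ~-+ : ∀ {x x′ y y′} → x ~ x′ → y ~ y′ →
          (λ n → x n ℚ.+ y n) ~ (λ n → x′ n ℚ.+ y′ n)
    ~-+ {x} {x′} {y} {y′} x~x′ y~y′ ε ε>0
      with M , h ← x~x′ (half ε) (half>0 ε ε>0) | N , k ← y~y′ (half ε) (half>0 ε ε>0) =
      M ℕ.⊔ N , λ m n ≤m ≤n →
        subst (λ t → ∣ t ∣ ℚ.< ε) (≡.sym (split-+ (x m) (y m) (x′ n) (y′ n)))
          (∣+∣< (h m n (⊔ˡ ≤m) (⊔ˡ ≤n)) (k m n (⊔ʳ {M} ≤m) (⊔ʳ {M} ≤n)))

    ~-neg : ∀ {x x′} → x ~ x′ → (λ n → ℚ.- x n) ~ (λ n → ℚ.- x′ n)
    ~-neg {x} {x′} x~x′ ε ε>0 with N , h ← x~x′ ε ε>0 = N , λ m n N≤m N≤n →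
      subst (ℚ._< ε)
        (≡.trans (≡.sym (ℚ.∣-p∣≡∣p∣ (x m ℚ.- x′ n))) (cong ∣_∣ (ℚ.neg-distrib-+ (x m) (ℚ.- x′ n))))
        (h m n N≤m N≤n)

    eventually-bounded : ∀ {x y} → x ~ y →
      Σ ℚ λ K → 0ℚ ℚ.< K × Σ ℕ λ N → ∀ m → N ℕ.≤ m → ∣ x m ∣ ℚ.< K
    eventually-bounded {x} {y} x~y with N , h ← x~y 1ℚ (ℚ.positive⁻¹ 1ℚ) =
      1ℚ ℚ.+ ∣ y N ∣ , ℚ.+-mono-<-≤ (ℚ.positive⁻¹ 1ℚ) (ℚ.0≤∣p∣ (y N)) , N , λ m N≤m →
        subst (λ t → ∣ t ∣ ℚ.< 1ℚ ℚ.+ ∣ y N ∣) (//-rightDividesˡ (y N) (x m))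
          (ℚ.≤-<-trans (ℚ.∣p+q∣≤∣p∣+∣q∣ (x m ℚ.- y N) (y N))
            (ℚ.+-mono-<-≤ (h m N N≤m ℕ.≤-refl) (ℚ.≤-refl {∣ y N ∣})))

    shrink : ∀ K ε → 0ℚ ℚ.< K → 0ℚ ℚ.< ε → Σ ℚ λ δ → 0ℚ ℚ.< δ ×
      (∀ p q → ∣ p ∣ ℚ.< K → ∣ q ∣ ℚ.< δ → ∣ p ℚ.* q ∣ ℚ.< ε)
    shrink K ε K>0 ε>0 = δ , δ>0 , bound
      where
      instance
        K-pos : ℚ.Positive K
        K-pos = ℚ.positive K>0

        K-nonZero : ℚ.NonZero K
        K-nonZero = ℚ.pos⇒nonZero K

        K⁻¹-pos : ℚ.Positive (ℚ.1/ K)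
        K⁻¹-pos = ℚ.1/pos⇒pos K

      δ : ℚ
      δ = ℚ.1/ K ℚ.* ε

      δ>0 : 0ℚ ℚ.< δ
      δ>0 = subst (ℚ._< δ) (ℚ.*-zeroʳ (ℚ.1/ K)) (ℚ.*-monoʳ-<-pos (ℚ.1/ K) ε>0)

      Kδ≡ε : K ℚ.* δ ≡ ε
      Kδ≡ε = ≡.trans (≡.sym (ℚ.*-assoc K (ℚ.1/ K) ε))
        (≡.trans (cong (ℚ._* ε) (ℚ.*-inverseʳ K)) (ℚ.*-identityˡ ε))

      bound : ∀ p q → ∣ p ∣ ℚ.< K → ∣ q ∣ ℚ.< δ → ∣ p ℚ.* q ∣ ℚ.< ε
      bound p q p<K q<δ = subst (ℚ._< ε) (≡.sym (ℚ.∣p*q∣≡∣p∣*∣q∣ p q))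
        (subst (∣ p ∣ ℚ.* ∣ q ∣ ℚ.<_) Kδ≡ε
          (ℚ.≤-<-trans
            (ℚ.*-monoʳ-≤-nonNeg ∣ q ∣ {{ℚ.∣-∣-nonNeg q}} (ℚ.<⇒≤ p<K))
            (ℚ.*-monoʳ-<-pos K q<δ)))

    ~-* : ∀ {x x′ y y′} → x ~ x′ → y ~ y′ →
          (λ n → x n ℚ.* y n) ~ (λ n → x′ n ℚ.* y′ n)
    ~-* {x} {x′} {y} {y′} x~x′ y~y′ ε ε>0
      with K , K>0 , A , x<K ← eventually-bounded {x} {x′} x~x′
         | L , L>0 , B , y′<L ← eventually-bounded {y′} {y} (~-sym {y} {y′} y~y′)
      with δ , δ>0 , bx ← shrink K (half ε) K>0 (half>0 ε ε>0)
         | η , η>0 , by ← shrink L (half ε) L>0 (half>0 ε ε>0)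
      with M , h ← y~y′ δ δ>0 | N , k ← x~x′ η η>0 =
      (A ℕ.⊔ B) ℕ.⊔ (M ℕ.⊔ N) , λ m n ≤m ≤n →
        subst (λ t → ∣ t ∣ ℚ.< ε) (≡.sym (split-* (x m) (y m) (x′ n) (y′ n)))
          (∣+∣<
            (bx (x m) (y m ℚ.- y′ n) (x<K m (⊔ˡ (⊔ˡ {A ℕ.⊔ B} ≤m)))
              (h m n (⊔ˡ (⊔ʳ {A ℕ.⊔ B} ≤m)) (⊔ˡ (⊔ʳ {A ℕ.⊔ B} ≤n))))
            (by (y′ n) (x m ℚ.- x′ n) (y′<L n (⊔ʳ {A} (⊔ˡ {A ℕ.⊔ B} ≤n)))
              (k m n (⊔ʳ {M} (⊔ʳ {A ℕ.⊔ B} ≤m)) (⊔ʳ {M} (⊔ʳ {A ℕ.⊔ B} ≤n)))))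

  infixl 6 _+_
  infixl 7 _*_
  infix  8 -_

  fromℚ : ℚ → ℝ
  fromℚ q = record { seq = λ _ → q ; cauchy = ~-const q }

  _+_ _*_ : ℝ → ℝ → ℝ
  x + y = record { seq = λ n → seq x n ℚ.+ seq y n ; cauchy = ~-+ {seq x} {seq x} {seq y} {seq y} (cauchy x) (cauchy y) }
  x * y = record { seq = λ n → seq x n ℚ.* seq y n ; cauchy = ~-* {seq x} {seq x} {seq y} {seq y} (cauchy x) (cauchy y) }

  -_ : ℝ → ℝ
  - x = record { seq = λ n → ℚ.- seq x n ; cauchy = ~-neg {seq x} {seq x} (cauchy x) }

  private
    pointwise : ∀ x y → (∀ n → seq x n ≡ seq y n) → x ≈ y
    pointwise x y eq = ~-resp {seq y} {seq y} {seq x} (λ n → ≡.sym (eq n)) (cauchy y)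

  ℝ-commutativeRing : CommutativeRing 0ℓ 0ℓ
  ℝ-commutativeRing = record
    { Carrier = ℝ
    ; _≈_ = _≈_
    ; _+_ = _+_
    ; _*_ = _*_
    ; -_ = -_
    ; 0# = fromℚ 0ℚ
    ; 1# = fromℚ 1ℚ
    ; isCommutativeRing = record
      { isRing = record
        { +-isAbelianGroup = record
          { isGroup = record
            { isMonoid = record
              { isSemigroup = record
                { isMagma = record
                  { isEquivalence = record
                    { refl = λ {x} → cauchy x
                    ; sym = λ {x} {y} → ~-sym {seq x} {seq y}
                    ; trans = λ {x} {y} {z} → ~-trans {seq x} {seq y} {seq z}
                    }
                  ; ∙-cong = λ {x} {y} {u} {v} → ~-+ {seq x} {seq y} {seq u} {seq v}
                  }
                ; assoc = λ x y z → pointwise ((x + y) + z) (x + (y + z))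
                    λ n → ℚ.+-assoc (seq x n) (seq y n) (seq z n)
                }
              ; identity = (λ x → pointwise (fromℚ 0ℚ + x) x λ n → ℚ.+-identityˡ (seq x n))
                         , (λ x → pointwise (x + fromℚ 0ℚ) x λ n → ℚ.+-identityʳ (seq x n))
              }
            ; inverse = (λ x → pointwise (- x + x) (fromℚ 0ℚ) λ n → ℚ.+-inverseˡ (seq x n))
                      , (λ x → pointwise (x + - x) (fromℚ 0ℚ) λ n → ℚ.+-inverseʳ (seq x n))
            ; ⁻¹-cong = λ {x} {y} → ~-neg {seq x} {seq y}
            }
          ; comm = λ x y → pointwise (x + y) (y + x) λ n → ℚ.+-comm (seq x n) (seq y n)
          }
        ; *-cong = λ {x} {y} {u} {v} → ~-* {seq x} {seq y} {seq u} {seq v}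
        ; *-assoc = λ x y z → pointwise ((x * y) * z) (x * (y * z))
            λ n → ℚ.*-assoc (seq x n) (seq y n) (seq z n)
        ; *-identity = (λ x → pointwise (fromℚ 1ℚ * x) x λ n → ℚ.*-identityˡ (seq x n))
                     , (λ x → pointwise (x * fromℚ 1ℚ) x λ n → ℚ.*-identityʳ (seq x n))
        ; distrib = (λ x y z → pointwise (x * (y + z)) (x * y + x * z)
                      λ n → ℚ.*-distribˡ-+ (seq x n) (seq y n) (seq z n))
                  , (λ x y z → pointwise ((y + z) * x) (y * x + z * x)
                      λ n → ℚ.*-distribʳ-+ (seq x n) (seq y n) (seq z n))
        }
      ; *-comm = λ x y → pointwise (x * y) (y * x) λ n → ℚ.*-comm (seq x n) (seq y n)
      }
    }

module Complexify {c ℓ} (R : CommutativeRing c ℓ) where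

  private
    module R = CommutativeRing R

  -- (re , im) stands for re + im i with i² = -1.
  Complex : Set c
  Complex = R.Carrier × R.Carrier

  infix  4 _≈_
  infixl 6 _+_
  infixl 7 _*_
  infix  8 -_

  _≈_ : Complex → Complex → Set ℓ
  (x , y) ≈ (u , v) = x R.≈ u × y R.≈ v

  _+_ _*_ : Complex → Complex → Complex
  (x , y) + (u , v) = x R.+ u , y R.+ v
  (x , y) * (u , v) = x R.* u R.- y R.* v , x R.* v R.+ y R.* u

  -_ : Complex → Complex
  - (x , y) = R.- x , R.- y

  0# 1# : Complex
  0# = R.0# , R.0#
  1# = R.1# , R.0#

  private
    open RingProperties R.ring using (-‿distribˡ-*; -‿distribʳ-*; -‿+-comm; -0#≈0#)
    open CommutativeSemigroupProperties R.+-commutativeSemigroup using (interchange)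
    open NaturalCoefficientsSolver R.commutativeSemiring using (solve; _:=_; _:+_; _:*_)
    open ≈-Reasoning R.setoid

    ≈-refl : ∀ {z} → z ≈ z
    ≈-refl = R.refl , R.refl

    ≈-sym : ∀ {z w} → z ≈ w → w ≈ z
    ≈-sym (p , q) = R.sym p , R.sym q

    ≈-trans : ∀ {z w t} → z ≈ w → w ≈ t → z ≈ t
    ≈-trans (p , q) (p′ , q′) = R.trans p p′ , R.trans q q′

    +-cong : ∀ {z z′ w w′} → z ≈ z′ → w ≈ w′ → z + w ≈ z′ + w′
    +-cong (p , q) (p′ , q′) = R.+-cong p p′ , R.+-cong q q′

    *-cong : ∀ {z z′ w w′} → z ≈ z′ → w ≈ w′ → z * w ≈ z′ * w′
    *-cong (p , q) (p′ , q′) =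
      R.+-cong (R.*-cong p p′) (R.-‿cong (R.*-cong q q′)) ,
      R.+-cong (R.*-cong p q′) (R.*-cong q p′)

    *-comm : ∀ z w → z * w ≈ w * z
    *-comm (x , y) (u , v) =
      R.+-cong (R.*-comm x u) (R.-‿cong (R.*-comm y v)) ,
      R.trans (R.+-comm _ _) (R.+-cong (R.*-comm y u) (R.*-comm x v))

    *-identityˡ : ∀ z → 1# * z ≈ z
    *-identityˡ (x , y) =
      R.trans (R.+-cong (R.*-identityˡ x) (R.trans (R.-‿cong (R.zeroˡ y)) -0#≈0#))
        (R.+-identityʳ x) ,
      R.trans (R.+-cong (R.*-identityˡ y) (R.zeroˡ x)) (R.+-identityʳ y)

    distribˡ : ∀ z w t → z * (w + t) ≈ z * w + z * t
    distribˡ (x , y) (u , v) (s , t) =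
      R.trans (R.+-cong (R.distribˡ x u s)
          (R.trans (R.-‿cong (R.distribˡ y v t)) (R.sym (-‿+-comm _ _))))
        (interchange _ _ _ _) ,
      R.trans (R.+-cong (R.distribˡ x v t) (R.distribˡ y u s)) (interchange _ _ _ _)

    *-assoc : ∀ z w t → (z * w) * t ≈ z * (w * t)
    *-assoc (x , y) (u , v) (s , t) = re , im
      where
      re = begin
        (x R.* u R.- y R.* v) R.* s R.- (x R.* v R.+ y R.* u) R.* t
          ≈⟨ R.+-cong (R.*-congʳ (R.+-congˡ (-‿distribˡ-* y v)))
               (R.trans (-‿distribˡ-* _ t) (R.*-congʳ (R.trans (R.sym (-‿+-comm _ _))
                 (R.+-cong (-‿distribʳ-* x v) (-‿distribˡ-* y u))))) ⟩
        (x R.* u R.+ (R.- y) R.* v) R.* s R.+ (x R.* (R.- v) R.+ (R.- y) R.* u) R.* t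
          ≈⟨ solve 7 (λ x y′ u v v′ s t →
               (x :* u :+ y′ :* v) :* s :+ (x :* v′ :+ y′ :* u) :* t :=
               x :* (u :* s :+ v′ :* t) :+ y′ :* (u :* t :+ v :* s))
               R.refl x (R.- y) u v (R.- v) s t ⟩
        x R.* (u R.* s R.+ (R.- v) R.* t) R.+ (R.- y) R.* (u R.* t R.+ v R.* s)
          ≈⟨ R.+-cong (R.*-congˡ (R.+-congˡ (-‿distribˡ-* v t))) (-‿distribˡ-* y _) ⟨
        x R.* (u R.* s R.- v R.* t) R.- y R.* (u R.* t R.+ v R.* s) ∎

      im = begin
        (x R.* u R.- y R.* v) R.* t R.+ (x R.* v R.+ y R.* u) R.* s
          ≈⟨ R.+-congʳ (R.*-congʳ (R.+-congˡ (-‿distribʳ-* y v))) ⟩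
        (x R.* u R.+ y R.* (R.- v)) R.* t R.+ (x R.* v R.+ y R.* u) R.* s
          ≈⟨ solve 7 (λ x y u v v′ s t →
               (x :* u :+ y :* v′) :* t :+ (x :* v :+ y :* u) :* s :=
               x :* (u :* t :+ v :* s) :+ y :* (u :* s :+ v′ :* t))
               R.refl x y u v (R.- v) s t ⟩
        x R.* (u R.* t R.+ v R.* s) R.+ y R.* (u R.* s R.+ (R.- v) R.* t)
          ≈⟨ R.+-congˡ (R.*-congˡ (R.+-congˡ (-‿distribˡ-* v t))) ⟨
        x R.* (u R.* t R.+ v R.* s) R.+ y R.* (u R.* s R.- v R.* t) ∎

  commutativeRing : CommutativeRing c ℓ
  commutativeRing = record
    { Carrier = Complex
    ; _≈_ = _≈_
    ; _+_ = _+_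
    ; _*_ = _*_
    ; -_ = -_
    ; 0# = 0#
    ; 1# = 1#
    ; isCommutativeRing = record
      { isRing = record
        { +-isAbelianGroup = record
          { isGroup = record
            { isMonoid = record
              { isSemigroup = record
                { isMagma = record
                  { isEquivalence = record
                    { refl = ≈-refl
                    ; sym = ≈-sym
                    ; trans = ≈-trans
                    }
                  ; ∙-cong = +-cong
                  }
                ; assoc = λ (x , y) (u , v) (s , t) → R.+-assoc x u s , R.+-assoc y v t
                }
              ; identity = (λ (x , y) → R.+-identityˡ x , R.+-identityˡ y)
                         , (λ (x , y) → R.+-identityʳ x , R.+-identityʳ y)
              }
            ; inverse = (λ (x , y) → R.-‿inverseˡ x , R.-‿inverseˡ y)
                      , (λ (x , y) → R.-‿inverseʳ x , R.-‿inverseʳ y)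
            ; ⁻¹-cong = λ (p , q) → R.-‿cong p , R.-‿cong q
            }
          ; comm = λ (x , y) (u , v) → R.+-comm x u , R.+-comm y v
          }
        ; *-cong = *-cong
        ; *-assoc = *-assoc
        ; *-identity = *-identityˡ
                     , (λ z → ≈-trans (*-comm z 1#) (*-identityˡ z))
        ; distrib = distribˡ
                  , (λ z w t → ≈-trans (*-comm (w + t) z)
                      (≈-trans (distribˡ z w t) (+-cong (*-comm z w) (*-comm z t))))
        }
      ; *-comm = *-comm
      }
    }

ℂ-commutativeRing : CommutativeRing 0ℓ 0ℓ
ℂ-commutativeRing = Complexify.commutativeRing Real.ℝ-commutativeRing

ℂ : Set
ℂ = CommutativeRing.Carrier ℂ-commutativeRing

module PowerSeries {c ℓ} (R : CommutativeRing c ℓ) where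

  private
    module R = CommutativeRing R

  open import Algebra.Properties.Monoid.Sum R.+-monoid using (sum-syntax)

  -- s n is the coefficient of xⁿ.
  Series : Set c
  Series = ℕ → R.Carrier

  infix  4 _≋_
  infixl 6 _+_ _-_
  infixl 7 _*_ _/_
  infix  8 -_
  infixr 8 _^_
  infixr 9 _⟨_⟩

  _≋_ : Series → Series → Set ℓ
  s ≋ t = ∀ n → s n R.≈ t n

  C : R.Carrier → Series
  C r zero    = r
  C r (suc _) = R.0#

  X : Series
  X 1 = R.1#
  X _ = R.0#

  1ₛ : Series
  1ₛ = C R.1#

  _+_ _-_ _*_ : Series → Series → Series
  (s + t) n = s n R.+ t n
  (s - t) n = s n R.- t n
  (s * t) n = ∑[ i < suc n ] (s (toℕ i) R.* t (n ℕ.∸ toℕ i))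

  -_ : Series → Series
  (- s) n = R.- s n

  _^_ : Series → ℕ → Series
  s ^ zero  = 1ₛ
  s ^ suc k = s * s ^ k

  -- The composite u(f(x)) = Σₖ uₖ f(x)ᵏ, for f(0) = 0: then the terms with
  -- k > n do not contribute to the coefficient of xⁿ.
  _⟨_⟩ : Series → Series → Series
  (u ⟨ f ⟩) n = ∑[ k < suc n ] (u (toℕ k) R.* (f ^ toℕ k) n)

  -- Division by a series p with p(0) = 1, through the geometric series
  -- 1/p = Σₖ (1 - p)ᵏ.
  _/_ : Series → Series → Series
  s / p = s * (λ _ → R.1#) ⟨ 1ₛ - p ⟩

  RiordanPair : Set c
  RiordanPair = Series × Series

  IsRiordan : RiordanPair → Set ℓ
  IsRiordan (g , f) = g 0 R.≈ R.1# × f 0 R.≈ R.0# × ¬ (f 1 R.≈ R.0#)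

  entry : RiordanPair → ℕ → ℕ → R.Carrier
  entry (g , f) n k = (g * f ^ k) n

  infix 4 _≈ᴿ_
  _≈ᴿ_ : RiordanPair → RiordanPair → Set ℓ
  A ≈ᴿ A′ = ∀ n k → entry A n k R.≈ entry A′ n k

  infixl 7 _·_
  _·_ : RiordanPair → RiordanPair → RiordanPair
  (g , f) · (u , v) = g * u ⟨ f ⟩ , v ⟨ f ⟩

  identity : RiordanPair
  identity = 1ₛ , X

  bell : Series → RiordanPair
  bell g = g , X * g

  IsBellPseudoInvolution : Series → Set ℓ
  IsBellPseudoInvolution g =
    IsRiordan (bell g) × (g , - (X * g)) · (g , - (X * g)) ≈ᴿ identity

  -- The entry in row n and column k - 1, which is 0 for k = 0.
  leftEntry : RiordanPair → ℕ → ℕ → R.Carrier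
  leftEntry A n zero    = R.0#
  leftEntry A n (suc k) = entry A n k

  -- The terms of the recurrence with j > n lie in negative rows and vanish.
  -- A sequence is identified with its generating function.
  IsBSequence : Series → Series → Set ℓ
  IsBSequence g b = ∀ n k →
    entry (bell g) (suc n) k R.≈
      leftEntry (bell g) n k R.+
      ∑[ j < suc n ] (b (toℕ j) R.* entry (bell g) (n ℕ.∸ toℕ j) (k ℕ.+ toℕ j))

  -- Convergence in the x-adic topology.
  _⟶_ : (ℕ → Series) → Series → Set ℓ
  s ⟶ g = ∀ N → ∃ λ M → ∀ n → M ℕ.≤ n → ∀ k → k ℕ.< N → s n k R.≈ g k

  -- The truncations d, d + e/d, d + e/(d + e/d), … of d + e/(d + e/(d + ⋯)).
  truncation : Series → Series → ℕ → Series
  truncation d e zero    = d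
  truncation d e (suc n) = d + e / truncation d e n

  -- g = 1/(d + e/(d + e/(d + ⋯)))
  _IsContinuedFraction[_,_] : Series → Series → Series → Set ℓ
  g IsContinuedFraction[ d , e ] = (λ n → 1ₛ / truncation d e n) ⟶ g

open PowerSeries ℂ-commutativeRing public

{-# OPTIONS --safe #-}
module Submission where

-- Column 0 of the B-sequence recurrence says g = 1 + x g B(x²g). Clearing the
-- denominator of B turns this into the quadratic equation d g + e g² = 1 with
-- d = 1 - ax - bx² and e = x²(b + cx). If p and p′ are consecutive truncations
-- of the continued fraction, then p′ = d + e/p and
-- g - 1/p′ = (1/p′) e g (1/p - g), so each step gains precision because e(0) = 0.

open import Algebra.Bundles using (CommutativeRing)
import Algebra.Properties.AbelianGroup as AbelianGroupProperties
import Algebra.Properties.CommutativeMonoid.Sum as SumProperties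
import Algebra.Properties.CommutativeSemigroup as CommutativeSemigroupProperties
import Algebra.Properties.Semiring.Sum as SemiringSumProperties
import Algebra.Solver.Ring.NaturalCoefficients.Default as NaturalCoefficientsSolver
open import Data.Fin.Base using (toℕ)
open import Data.Nat.Base as ℕ using (ℕ; zero; suc; z≤n; s≤s)
import Data.Nat.Properties as ℕ
open import Data.Product.Base using (_×_; _,_)
open import Relation.Binary.PropositionalEquality.Core using (_≡_; refl)
import Relation.Binary.Reasoning.Setoid as ≈-Reasoning
open import Defs using (module PowerSeries)

module PowerSeriesProperties {c ℓ} (R : CommutativeRing c ℓ) where

  private
    module R = CommutativeRing R
    module R+ = AbelianGroupProperties R.+-abelianGroup
    module R+ˢ = CommutativeSemigroupProperties R.+-commutativeSemigroup

  open PowerSeries R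
  open SumProperties R.+-commutativeMonoid using (sum-cong-≋; sum-replicate-zero; sum-syntax; ∑-distrib-+)
  open SemiringSumProperties R.semiring using (*-distribˡ-sum)

  -- The commutative ring of formal power series.

  tail : Series → Series
  tail s n = s (suc n)

  0ₛ : Series
  0ₛ _ = R.0#

  infix 4 _≋[_]_
  _≋[_]_ : Series → ℕ → Series → Set ℓ
  s ≋[ N ] t = ∀ k → k ℕ.< N → s k R.≈ t k

  -- Coefficient `k` of a product reads the factors only up to `k`; the precision `N` is explicit
  -- because the approximation arguments below know a factor only up to some degree. The recursion,
  -- as in most ring laws below, uses that coefficient `suc n` of `s * t` is definitionally
  -- `s 0 R.* t (suc n)` plus coefficient `n` of `tail s * t`.
  *-cong-[] : ∀ N {s s′ t t′} → s ≋[ N ] s′ → t ≋[ N ] t′ → s * t ≋[ N ] s′ * t′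
  *-cong-[] (suc N) p q zero    _         = R.+-congʳ (R.*-cong (p 0 (s≤s z≤n)) (q 0 (s≤s z≤n)))
  *-cong-[] (suc N) p q (suc k) (s≤s k<N) =
    R.+-cong (R.*-cong (p 0 (s≤s z≤n)) (q (suc k) (s≤s k<N)))
      (*-cong-[] N (λ i i<N → p (suc i) (s≤s i<N)) (λ i i<N → q i (ℕ.m≤n⇒m≤1+n i<N)) k k<N)

  *-cong : ∀ {s s′ t t′} → s ≋ s′ → t ≋ t′ → s * t ≋ s′ * t′
  *-cong p q n = *-cong-[] (suc n) (λ k _ → p k) (λ k _ → q k) n ℕ.≤-refl

  *-congˡ : ∀ s {t t′} → t ≋ t′ → s * t ≋ s * t′
  *-congˡ s p = *-cong {s} {s} (λ _ → R.refl) p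

  *-congʳ : ∀ t {s s′} → s ≋ s′ → s * t ≋ s′ * t
  *-congʳ t p = *-cong {t = t} {t} p (λ _ → R.refl)

  *-zeroˡ : ∀ t → 0ₛ * t ≋ 0ₛ
  *-zeroˡ t zero    = R.trans (R.+-identityʳ _) (R.zeroˡ _)
  *-zeroˡ t (suc n) = R.trans (R.+-cong (R.zeroˡ _) (*-zeroˡ t n)) (R.+-identityʳ _)

  C-* : ∀ r t → C r * t ≋ (λ n → r R.* t n)
  C-* r t zero    = R.+-identityʳ _
  C-* r t (suc n) = R.trans (R.+-congˡ (*-zeroˡ t n)) (R.+-identityʳ _)

  *-distribʳ : ∀ u s t → (s + t) * u ≋ s * u + t * u
  *-distribʳ u s t zero    = R.trans (R.+-cong (R.distribʳ _ _ _) (R.sym (R.+-identityʳ _)))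
    (R+ˢ.interchange _ _ _ _)
  *-distribʳ u s t (suc n) = R.trans
    (R.+-cong (R.distribʳ _ _ _) (*-distribʳ u (tail s) (tail t) n))
    (R+ˢ.interchange _ _ _ _)

  *-scaleˡ : ∀ r s t → (λ n → r R.* s n) * t ≋ (λ n → r R.* (s * t) n)
  *-scaleˡ r s t zero    = R.trans (R.+-cong (R.*-assoc _ _ _) (R.sym (R.zeroʳ r)))
    (R.sym (R.distribˡ r _ _))
  *-scaleˡ r s t (suc n) = R.trans (R.+-cong (R.*-assoc _ _ _) (*-scaleˡ r (tail s) t n))
    (R.sym (R.distribˡ r _ _))

  -- The sum split at its last summand, mirroring the definitional split at the first; comparing the
  -- two splits yields commutativity.
  *-suc : ∀ s t n → (s * t) (suc n) R.≈ (s * tail t) n R.+ s (suc n) R.* t 0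
  *-suc s t zero    = R.+-cong (R.sym (R.+-identityʳ _)) (R.+-identityʳ _)
  *-suc s t (suc n) = R.trans (R.+-congˡ (*-suc (tail s) t n)) (R.sym (R.+-assoc _ _ _))

  *-comm : ∀ s t → s * t ≋ t * s
  *-comm s t zero    = R.+-congʳ (R.*-comm _ _)
  *-comm s t (suc n) = R.trans (*-suc s t n)
    (R.trans (R.+-comm _ _) (R.+-cong (R.*-comm _ _) (*-comm s (tail t) n)))

  *-assoc : ∀ s t u → (s * t) * u ≋ s * (t * u)
  *-assoc s t u zero    = R.+-congʳ
    (R.trans (R.*-congʳ (R.+-identityʳ _)) (R.trans (R.*-assoc _ _ _) (R.*-congˡ (R.sym (R.+-identityʳ _)))))
  *-assoc s t u (suc n) = begin
    (s * t) 0 R.* u (suc n) R.+ (tail (s * t) * u) n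
      -- `tail (s * t)` is definitionally `s 0` times `tail t`, plus `tail s * t`.
      ≈⟨ R.+-cong (R.trans (R.*-congʳ (R.+-identityʳ _)) (R.*-assoc _ _ _))
           (R.trans (*-distribʳ u (λ k → s 0 R.* tail t k) (tail s * t) n)
             (R.+-cong (*-scaleˡ (s 0) (tail t) u n) (*-assoc (tail s) t u n))) ⟩
    s 0 R.* (t 0 R.* u (suc n)) R.+ (s 0 R.* (tail t * u) n R.+ (tail s * (t * u)) n)
      ≈⟨ R.+-assoc _ _ _ ⟨
    s 0 R.* (t 0 R.* u (suc n)) R.+ s 0 R.* (tail t * u) n R.+ (tail s * (t * u)) n
      ≈⟨ R.+-congʳ (R.distribˡ _ _ _) ⟨
    (s * (t * u)) (suc n) ∎
    where open ≈-Reasoning R.setoid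

  *-identityˡ : ∀ t → 1ₛ * t ≋ t
  *-identityˡ t n = R.trans (C-* R.1# t n) (R.*-identityˡ _)

  series-commutativeRing : CommutativeRing c ℓ
  series-commutativeRing = record
    { Carrier = Series
    ; _≈_ = _≋_
    ; _+_ = _+_
    ; _*_ = _*_
    ; -_ = -_
    ; 0# = 0ₛ
    ; 1# = 1ₛ
    ; isCommutativeRing = record
      { isRing = record
        { +-isAbelianGroup = record
          { isGroup = record
            { isMonoid = record
              { isSemigroup = record
                { isMagma = record
                  { isEquivalence = record
                    { refl = λ _ → R.refl
                    ; sym = λ p n → R.sym (p n)
                    ; trans = λ p q n → R.trans (p n) (q n)
                    }
                  ; ∙-cong = λ p q n → R.+-cong (p n) (q n)
                  }
                ; assoc = λ _ _ _ _ → R.+-assoc _ _ _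
                }
              ; identity = (λ _ _ → R.+-identityˡ _) , (λ _ _ → R.+-identityʳ _)
              }
            ; inverse = (λ _ _ → R.-‿inverseˡ _) , (λ _ _ → R.-‿inverseʳ _)
            ; ⁻¹-cong = λ p n → R.-‿cong (p n)
            }
          ; comm = λ _ _ _ → R.+-comm _ _
          }
        ; *-cong = λ {s} {s′} {t} {t′} → *-cong {s} {s′} {t} {t′}
        ; *-assoc = *-assoc
        ; *-identity = *-identityˡ , λ t n → R.trans (*-comm t 1ₛ n) (*-identityˡ t n)
        ; distrib = (λ s t u n → R.trans (*-comm s (t + u) n)
                      (R.trans (*-distribʳ s t u n) (R.+-cong (*-comm t s n) (*-comm u s n))))
                  , *-distribʳ
        }
      ; *-comm = *-comm
      }
    }

  tail-X : tail X ≋ 1ₛ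
  tail-X zero    = R.refl
  tail-X (suc _) = R.refl

  private
    module S = CommutativeRing series-commutativeRing
    module S+ = AbelianGroupProperties S.+-abelianGroup

  -- Composition with a series that has no constant term.

  module _ {f : Series} (f₀ : f 0 R.≈ R.0#) where

    *-constant-zero : ∀ s → (f * s) 0 R.≈ R.0#
    *-constant-zero s = R.trans (R.+-identityʳ _) (R.trans (R.*-congʳ f₀) (R.zeroˡ _))

    -- Since `f 0` vanishes, coefficient `suc k` of `f * s` reads `s` only up to `k`. This gain of
    -- one coefficient drives the approximation arguments below.
    *-gain : ∀ {s t} N → s ≋[ N ] t → f * s ≋[ suc N ] f * t
    *-gain {s} {t} N p zero    _         = R.trans (*-constant-zero s) (R.sym (*-constant-zero t))
    *-gain {s} {t} N p (suc k) (s≤s k<N) = R.+-cong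
      (R.trans (R.trans (R.*-congʳ f₀) (R.zeroˡ _)) (R.sym (R.trans (R.*-congʳ f₀) (R.zeroˡ _))))
      (*-cong-[] N {tail f} {tail f} (λ _ _ → R.refl) p k k<N)

    private
      -- A single series with a fixed cutoff `N`, whereas the cutoff in `u ⟨ f ⟩` moves with the
      -- coefficient.
      horner : Series → ℕ → Series
      horner u zero    = 0ₛ
      horner u (suc N) = C (u 0) + f * horner (tail u) N

      -- The factor `h` carries the induction: each Horner step moves one `f` into it, and `h = 1ₛ`
      -- gives the composite.
      *-horner : ∀ N u h n → (h * horner u N) n R.≈ ∑[ k < N ] (u (toℕ k) R.* (h * f ^ toℕ k) n)
      *-horner zero    u h n = S.zeroʳ h n
      *-horner (suc N) u h n = begin
        (h * (C (u 0) + f * P)) n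
          ≈⟨ S.distribˡ h (C (u 0)) (f * P) n ⟩
        (h * C (u 0)) n R.+ (h * (f * P)) n
          ≈⟨ R.+-cong (R.trans (*-comm h (C (u 0)) n) (C-* (u 0) h n)) (R.sym (*-assoc h f P n)) ⟩
        u 0 R.* h n R.+ (h * f * P) n
          ≈⟨ R.+-cong (R.*-congˡ (R.sym (S.*-identityʳ h n))) (*-horner N (tail u) (h * f) n) ⟩
        u 0 R.* (h * 1ₛ) n R.+ ∑[ k < N ] (u (suc (toℕ k)) R.* (h * f * f ^ toℕ k) n)
          ≈⟨ R.+-congˡ (sum-cong-≋ {N} λ k → R.*-congˡ (*-assoc h f (f ^ toℕ k) n)) ⟩
        u 0 R.* (h * 1ₛ) n R.+ ∑[ k < N ] (u (suc (toℕ k)) R.* (h * (f * f ^ toℕ k)) n) ∎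
        where
        open ≈-Reasoning R.setoid
        P = horner (tail u) N

      ⟨⟩-horner : ∀ u n → (u ⟨ f ⟩) n R.≈ horner u (suc n) n
      ⟨⟩-horner u n = R.trans
        (sum-cong-≋ {suc n} λ k → R.*-congˡ {u (toℕ k)} (R.sym (*-identityˡ (f ^ toℕ k) n)))
        (R.trans (R.sym (*-horner (suc n) u 1ₛ n)) (*-identityˡ (horner u (suc n)) n))

      -- Terms with at least `N` factors `f` vanish below degree `N`; in Horner form this is one
      -- `*-gain` per step.
      horner-stable : ∀ {N M} u → N ℕ.≤ M → horner u N ≋[ N ] horner u M
      horner-stable         u z≤n             k ()
      horner-stable {suc N} u (s≤s N≤M) k k< = R.+-congˡ
        (*-gain N (horner-stable (tail u) N≤M) k k<)

    -- Horner's rule for the whole composite. At coefficient `n` the tail is cut off at `n`, while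
    -- each lower coefficient of `tail u ⟨ f ⟩` has its own cutoff; `horner-stable` reconciles them
    -- and `*-gain` lifts the agreement below `n` to coefficient `n`.
    ⟨⟩-unfold : ∀ u → u ⟨ f ⟩ ≋ C (u 0) + f * tail u ⟨ f ⟩
    ⟨⟩-unfold u n = R.trans (⟨⟩-horner u n) (R.+-congˡ
      (*-gain n (λ k k<n → R.sym (R.trans (⟨⟩-horner (tail u) k)
        (horner-stable (tail u) k<n k ℕ.≤-refl))) n ℕ.≤-refl))

    ⟨⟩-cong : ∀ {u v} → u ≋ v → u ⟨ f ⟩ ≋ v ⟨ f ⟩
    ⟨⟩-cong p n = sum-cong-≋ {suc n} λ k → R.*-congʳ {(f ^ toℕ k) n} (p (toℕ k))

    ⟨⟩-zero : 0ₛ ⟨ f ⟩ ≋ 0ₛ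
    ⟨⟩-zero n = R.trans (sum-cong-≋ {suc n} λ k → R.zeroˡ ((f ^ toℕ k) n)) (sum-replicate-zero (suc n))

    ⟨⟩-C : ∀ r → C r ⟨ f ⟩ ≋ C r
    ⟨⟩-C r n = R.trans (⟨⟩-unfold (C r) n) (R.trans
      (R.+-congˡ (R.trans (*-congˡ f ⟨⟩-zero n) (S.zeroʳ f n)))
      (R.+-identityʳ _))

    ⟨⟩-+ : ∀ u v → (u + v) ⟨ f ⟩ ≋ u ⟨ f ⟩ + v ⟨ f ⟩
    ⟨⟩-+ u v n = R.trans (sum-cong-≋ {suc n} λ k → R.distribʳ ((f ^ toℕ k) n) (u (toℕ k)) (v (toℕ k)))
      (∑-distrib-+ {suc n} (λ k → u (toℕ k) R.* (f ^ toℕ k) n) (λ k → v (toℕ k) R.* (f ^ toℕ k) n))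

    ⟨⟩-X : X ⟨ f ⟩ ≋ f
    ⟨⟩-X n = begin
      (X ⟨ f ⟩) n
        ≈⟨ ⟨⟩-unfold X n ⟩
      C R.0# n R.+ (f * tail X ⟨ f ⟩) n
        ≈⟨ R.+-cong (C-zero n) (*-congˡ f
             (S.trans (⟨⟩-cong tail-X) (⟨⟩-C R.1#)) n) ⟩
      R.0# R.+ (f * 1ₛ) n
        ≈⟨ R.trans (R.+-identityˡ _) (S.*-identityʳ f n) ⟩
      f n ∎
      where
      open ≈-Reasoning R.setoid
      C-zero : C R.0# ≋ 0ₛ
      C-zero zero    = R.refl
      C-zero (suc _) = R.refl

    ⟨⟩-scale : ∀ r u → (λ n → r R.* u n) ⟨ f ⟩ ≋ C r * u ⟨ f ⟩
    ⟨⟩-scale r u n = R.trans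
      (R.trans (sum-cong-≋ {suc n} λ k → R.*-assoc r (u (toℕ k)) ((f ^ toℕ k) n))
        (R.sym (*-distribˡ-sum {suc n} r (λ k → u (toℕ k) R.* (f ^ toℕ k) n))))
      (R.sym (C-* r (u ⟨ f ⟩) n))

    ⟨⟩-* : ∀ u v → (u * v) ⟨ f ⟩ ≋ u ⟨ f ⟩ * v ⟨ f ⟩
    ⟨⟩-* u v n = upto (suc n) u n ℕ.≤-refl
      where
      open ≈-Reasoning R.setoid
      V = v ⟨ f ⟩

      -- By unfolding, both sides are C (u 0) * V + f * (the same for tail u),
      -- and the factor f gains one coefficient.
      upto : ∀ N u → (u * v) ⟨ f ⟩ ≋[ N ] u ⟨ f ⟩ * V
      upto (suc N) u k k< = begin
        ((u * v) ⟨ f ⟩) k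
          ≈⟨ ⟨⟩-unfold (u * v) k ⟩
        C ((u * v) 0) k R.+ (f * tail (u * v) ⟨ f ⟩) k
          ≈⟨ R.+-congˡ (*-congˡ f
               (S.trans (⟨⟩-+ (λ j → u 0 R.* tail v j) (tail u * v))
                 (S.+-congʳ {(tail u * v) ⟨ f ⟩} (⟨⟩-scale (u 0) (tail v)))) k) ⟩
        C ((u * v) 0) k R.+ (f * (C (u 0) * T + (tail u * v) ⟨ f ⟩)) k
          ≈⟨ R.+-congˡ (*-gain N (λ i i<N → R.+-congˡ {(C (u 0) * T) i} (upto N (tail u) i i<N)) k k<) ⟩
        C ((u * v) 0) k R.+ (f * (C (u 0) * T + U * V)) k
          ≈⟨ R.+-congʳ (C-product k) ⟩
        (C (u 0) * C (v 0)) k R.+ (f * (C (u 0) * T + U * V)) k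
          ≈⟨ solve 6 (λ a b f T U V → a :* b :+ f :* (a :* T :+ U :* V) :=
               a :* (b :+ f :* T) :+ f :* U :* V)
               (λ _ → R.refl) (C (u 0)) (C (v 0)) f T U V k ⟩
        (C (u 0) * (C (v 0) + f * T) + f * U * V) k
          ≈⟨ R.+-congʳ (*-congˡ (C (u 0)) (S.sym (⟨⟩-unfold v)) k) ⟩
        (C (u 0) * V + f * U * V) k
          ≈⟨ *-distribʳ V (C (u 0)) (f * U) k ⟨
        ((C (u 0) + f * U) * V) k
          ≈⟨ *-congʳ V (S.sym (⟨⟩-unfold u)) k ⟩
        (u ⟨ f ⟩ * V) k ∎
        where
        open NaturalCoefficientsSolver S.commutativeSemiring using (solve; _:=_; _:+_; _:*_)
        T = tail v ⟨ f ⟩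
        U = tail u ⟨ f ⟩
        C-product : C ((u * v) 0) ≋ C (u 0) * C (v 0)
        C-product zero    = R.refl
        C-product (suc i) = R.sym (R.trans (C-* (u 0) (C (v 0)) (suc i)) (R.zeroʳ _))

  -- Inverses of series with constant term 1.

  module _ {p : Series} (p₀ : p 0 R.≈ R.1#) where

    private
      1-p₀ : (1ₛ - p) 0 R.≈ R.0#
      1-p₀ = R.trans (R.+-congˡ (R.-‿cong p₀)) (R.-‿inverseʳ R.1#)

      1/p : Series
      1/p = (λ _ → R.1#) ⟨ 1ₛ - p ⟩

    -- The constant sequence 1 is its own tail, so one unfolding of the geometric series gives
    -- `1/p = 1 + (1 - p) * 1/p`. Adding `(1 - p) * 1/p` to both sides of the claim reduces it to
    -- this identity.
    *-inverse : p * 1/p ≋ 1ₛ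
    *-inverse = S+.∙-cancelʳ ((1ₛ - p) * 1/p) (p * 1/p) 1ₛ λ n → begin
      (p * 1/p + (1ₛ - p) * 1/p) n
        ≈⟨ *-distribʳ 1/p p (1ₛ - p) n ⟨
      ((p + (1ₛ - p)) * 1/p) n
        ≈⟨ *-congʳ 1/p {p + (1ₛ - p)} {1ₛ} (λ _ → R.trans (R.sym (R.+-assoc _ _ _)) (R+.xyx⁻¹≈y _ _)) n ⟩
      (1ₛ * 1/p) n
        ≈⟨ *-identityˡ 1/p n ⟩
      1/p n
        ≈⟨ ⟨⟩-unfold 1-p₀ (λ _ → R.1#) n ⟩
      (1ₛ + (1ₛ - p) * 1/p) n ∎
      where open ≈-Reasoning R.setoid

    /-cancel : ∀ s → s / p * p ≋ s
    /-cancel s n = begin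
      (s * 1/p * p) n
        ≈⟨ *-assoc s 1/p p n ⟩
      (s * (1/p * p)) n
        ≈⟨ *-congˡ s (S.trans (*-comm 1/p p) *-inverse) n ⟩
      (s * 1ₛ) n
        ≈⟨ S.*-identityʳ s n ⟩
      s n ∎
      where open ≈-Reasoning R.setoid

  -- From the recurrence of the B-sequence to a functional equation.

  X*-zero : ∀ s → (X * s) 0 R.≈ R.0#
  X*-zero = *-constant-zero {X} R.refl

  X*-suc : ∀ s n → (X * s) (suc n) R.≈ s n
  X*-suc s n = R.trans (R.+-cong (R.zeroˡ _) (*-congʳ s tail-X n))
    (R.trans (R.+-identityˡ _) (*-identityˡ s n))

  -- Coefficient `n - j` of `h * y ^ j` is coefficient `n` of `h * (X * y) ^ j`, so the sum collects
  -- into one composite. With `h = g` and `y = X * g` it is the sum in column 0 of the recurrence.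
  ∑-shifted-powers : ∀ n u h y →
    ∑[ j < suc n ] (u (toℕ j) R.* (h * y ^ toℕ j) (n ℕ.∸ toℕ j)) R.≈ (h * u ⟨ X * y ⟩) n
  ∑-shifted-powers n u h y = begin
    u 0 R.* (h * 1ₛ) n R.+ ∑[ j < n ] (u (suc (toℕ j)) R.* (h * (y * y ^ toℕ j)) (n ℕ.∸ suc (toℕ j)))
      ≈⟨ R.+-cong (R.trans (R.*-congˡ (S.*-identityʳ h n)) (R.sym (C-* (u 0) h n))) (rest n) ⟩
    (C (u 0) * h) n R.+ (X * (h * y * U)) n
      ≈⟨ solve 5 (λ c h x y U → c :* h :+ x :* (h :* y :* U) := h :* (c :+ x :* y :* U))
           (λ _ → R.refl) (C (u 0)) h X y U n ⟩
    (h * (C (u 0) + X * y * U)) n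
      ≈⟨ *-congˡ h (⟨⟩-unfold (X*-zero y) u) n ⟨
    (h * u ⟨ X * y ⟩) n ∎
    where
    open ≈-Reasoning R.setoid
    open NaturalCoefficientsSolver S.commutativeSemiring using (solve; _:=_; _:+_; _:*_)
    U = tail u ⟨ X * y ⟩

    -- Without `j = 0` the sum has the same shape, with `tail u` for `u` and one `y` absorbed into
    -- `h`; the row, lowered by one, accounts for the factor `X`.
    rest : ∀ n → ∑[ j < n ] (u (suc (toℕ j)) R.* (h * (y * y ^ toℕ j)) (n ℕ.∸ suc (toℕ j)))
                 R.≈ (X * (h * y * U)) n
    rest zero    = R.sym (X*-zero (h * y * U))
    rest (suc n) = begin
      ∑[ j < suc n ] (u (suc (toℕ j)) R.* (h * (y * y ^ toℕ j)) (n ℕ.∸ toℕ j))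
        ≈⟨ sum-cong-≋ {suc n} (λ j → R.*-congˡ {u (suc (toℕ j))} (R.sym (*-assoc h y (y ^ toℕ j) (n ℕ.∸ toℕ j)))) ⟩
      ∑[ j < suc n ] (u (suc (toℕ j)) R.* (h * y * y ^ toℕ j) (n ℕ.∸ toℕ j))
        ≈⟨ ∑-shifted-powers n (tail u) (h * y) y ⟩
      (h * y * U) n
        ≈⟨ X*-suc (h * y * U) n ⟨
      (X * (h * y * U)) (suc n) ∎

  bSequence-equation : ∀ {g B} → g 0 R.≈ R.1# → IsBSequence g B →
    g ≋ 1ₛ + X * (g * B ⟨ X * (X * g) ⟩)
  bSequence-equation {g} {B} g₀ isB zero = R.trans g₀
    (R.sym (R.trans (R.+-congˡ (X*-zero (g * B ⟨ X * (X * g) ⟩))) (R.+-identityʳ _)))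
  bSequence-equation {g} {B} g₀ isB (suc n) = begin
    g (suc n)
      ≈⟨ S.*-identityʳ g (suc n) ⟨
    (g * 1ₛ) (suc n)
      -- Column 0 has no left neighbour, whence the summand `R.0#`; it is kept because it ends up as
      -- coefficient `suc n` of `1ₛ`.
      ≈⟨ isB n 0 ⟩
    R.0# R.+ ∑[ j < suc n ] (B (toℕ j) R.* (g * (X * g) ^ toℕ j) (n ℕ.∸ toℕ j))
      ≈⟨ R.+-congˡ (∑-shifted-powers n B g (X * g)) ⟩
    R.0# R.+ (g * B ⟨ X * (X * g) ⟩) n
      ≈⟨ R.+-congˡ (X*-suc (g * B ⟨ X * (X * g) ⟩) n) ⟨
    R.0# R.+ (X * (g * B ⟨ X * (X * g) ⟩)) (suc n) ∎
    where open ≈-Reasoning R.setoid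

  -- Convergence of the continued fraction of a quadratic equation.

  quadratic⇒continuedFraction : ∀ {g d e} → d 0 R.≈ R.1# → e 0 R.≈ R.0# →
    d * g + e * (g * g) ≋ 1ₛ → g IsContinuedFraction[ d , e ]
  quadratic⇒continuedFraction {g} {d} {e} d₀ e₀ quadratic N =
    -- `approx n` makes the first `n` coefficients correct, so `N` itself serves as the threshold.
    N , λ n N≤n k k<N → R.trans (*-identityˡ (inv n) k) (approx n k (ℕ.<-≤-trans k<N N≤n))
    where
    open ≈-Reasoning R.setoid
    open NaturalCoefficientsSolver S.commutativeSemiring using (solve; _:=_; _:+_; _:*_)

    p inv : ℕ → Series
    p = truncation d e
    inv n = (λ _ → R.1#) ⟨ 1ₛ - p n ⟩

    p₀ : ∀ n → p n 0 R.≈ R.1#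
    p₀ zero    = d₀
    p₀ (suc n) = R.trans (R.+-cong d₀ (*-constant-zero {e} e₀ (inv n))) (R.+-identityʳ _)

    approx : ∀ n → inv n ≋[ n ] g
    approx (suc n) k k< = begin
      inv (suc n) k
        ≈⟨ S.*-identityʳ (inv (suc n)) k ⟨
      (inv (suc n) * 1ₛ) k
        ≈⟨ *-congˡ (inv (suc n)) quadratic k ⟨
      (inv (suc n) * (d * g + e * (g * g))) k
        -- One factor of `g * g` is replaced by `inv n`, which is correct below degree `n`; the
        -- factor `e` extends the agreement through degree `n`.
        ≈⟨ *-cong-[] (suc n) {inv (suc n)} {inv (suc n)} {d * g + e * (g * g)} {d * g + e * (g * inv n)}
             (λ _ _ → R.refl)
             (λ i i< → R.+-congˡ {(d * g) i} (*-gain {e} e₀ {g * g} {g * inv n} n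
               (*-cong-[] n {g} {g} (λ _ _ → R.refl) (λ j j< → R.sym (approx n j j<))) i i<)) k k< ⟩
      (inv (suc n) * (d * g + e * (g * inv n))) k
        -- Regrouping exposes `d + e * inv n`, definitionally the next truncation, which cancels
        -- against its inverse.
        ≈⟨ solve 5 (λ r d g e q → r :* (d :* g :+ e :* (g :* q)) := (d :+ e :* q) :* r :* g)
             (λ _ → R.refl) (inv (suc n)) d g e (inv n) k ⟩
      (p (suc n) * inv (suc n) * g) k
        ≈⟨ *-congʳ g (*-inverse {p (suc n)} (p₀ (suc n))) k ⟩
      (1ₛ * g) k
        ≈⟨ *-identityˡ g k ⟩
      g k ∎

  -- From the functional equation to the quadratic equation.

  bSequence⇒quadratic : ∀ {a b c g B} → g 0 R.≈ R.1# → IsBSequence g B →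
    B ≋ (C a - C c * X) / (1ₛ + C b * X) →
    (1ₛ - C a * X - C b * X ^ 2) * g + X ^ 2 * (C b + C c * X) * (g * g) ≋ 1ₛ
  bSequence⇒quadratic {a} {b} {c} {g} {B} g₀ isB B≋ =
    -- Since `w` is what `d` subtracts from 1, adding `w * g` leaves an identity without
    -- subtraction, as the semiring solver requires.
    S+.∙-cancelʳ (w * g) (d * g + X ^ 2 * (C b + C c * X) * (g * g)) 1ₛ (begin
      d * g + X ^ 2 * (C b + C c * X) * (g * g) + w * g
        ≈⟨ S.+-congʳ {w * g} (S.+-congˡ {d * g} (*-congʳ (g * g) (*-congʳ (C b + C c * X) X²))) ⟩
      d * g + X * X * (C b + C c * X) * (g * g) + w * g
        ≈⟨ solve 5 (λ d g e gg w → d :* g :+ e :* gg :+ w :* g := (d :+ w) :* g :+ e :* gg)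
             (λ _ → R.refl) d g (X * X * (C b + C c * X)) (g * g) w ⟩
      (d + w) * g + X * X * (C b + C c * X) * (g * g)
        ≈⟨ S.+-congʳ {X * X * (C b + C c * X) * (g * g)} (*-congʳ g d+w) ⟩
      1ₛ * g + X * X * (C b + C c * X) * (g * g)
        -- A factor `g` is brought next to `1ₛ + C b * f`, the denominator of `B` at `f = x²g`.
        ≈⟨ solve 5 (λ o x b c g →
             o :* g :+ x :* x :* (b :+ c :* x) :* (g :* g) :=
             g :* (o :+ b :* (x :* (x :* g))) :+ c :* (x :* (x :* g)) :* (x :* g))
             (λ _ → R.refl) 1ₛ X (C b) (C c) g ⟩
      g * (1ₛ + C b * f) + C c * f * (X * g)
        -- Expanding only this `g` puts `β = B(f)` next to its denominator, ready for `β-equation`.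
        ≈⟨ S.+-congʳ {C c * f * (X * g)} (*-congʳ (1ₛ + C b * f) (bSequence-equation {g} {B} g₀ isB)) ⟩
      (1ₛ + X * (g * β)) * (1ₛ + C b * f) + C c * f * (X * g)
        ≈⟨ solve 6 (λ o x g β q r →
             (o :+ x :* (g :* β)) :* q :+ r :* (x :* g) := o :* q :+ x :* g :* (β :* q :+ r))
             (λ _ → R.refl) 1ₛ X g β (1ₛ + C b * f) (C c * f) ⟩
      1ₛ * (1ₛ + C b * f) + X * g * (β * (1ₛ + C b * f) + C c * f)
        ≈⟨ S.+-cong (*-identityˡ (1ₛ + C b * f)) (*-congˡ (X * g) β-equation) ⟩
      1ₛ + C b * f + X * g * C a
        ≈⟨ solve 5 (λ o x a b g →
             o :+ b :* (x :* (x :* g)) :+ x :* g :* a := o :+ (a :* x :+ b :* (x :* x)) :* g)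
             (λ _ → R.refl) 1ₛ X (C a) (C b) g ⟩
      1ₛ + (C a * X + C b * (X * X)) * g
        ≈⟨ S.+-congˡ {1ₛ} (*-congʳ g (S.+-congˡ {C a * X} (*-congˡ (C b) X²))) ⟨
      1ₛ + w * g ∎)
    where
    open ≈-Reasoning S.setoid
    open NaturalCoefficientsSolver S.commutativeSemiring using (solve; _:=_; _:+_; _:*_)

    d w f β : Series
    d = 1ₛ - C a * X - C b * X ^ 2
    w = C a * X + C b * X ^ 2
    f = X * (X * g)
    β = B ⟨ f ⟩

    f₀ : f 0 R.≈ R.0#
    f₀ = X*-zero (X * g)

    X² : X ^ 2 ≋ X * X
    X² = *-congˡ X (S.*-identityʳ X)

    d+w : d + w ≋ 1ₛ
    d+w _ = R.trans (R.+-congʳ (R.trans (R.+-assoc _ _ _) (R.+-congˡ (R+.⁻¹-∙-comm _ _))))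
      (R+.//-rightDividesˡ _ _)

    scaled-X : ∀ r → (C r * X) ⟨ f ⟩ ≋ C r * f
    scaled-X r = S.trans (⟨⟩-* f₀ (C r) X) (*-cong (⟨⟩-C f₀ r) (⟨⟩-X f₀))

    p₀ : (1ₛ + C b * X) 0 R.≈ R.1#
    p₀ = R.trans (R.+-congˡ (R.trans (C-* b X 0) (R.zeroʳ b))) (R.+-identityʳ _)

    -- With the denominator cleared and `C c * X` moved to the left, substituting `f` needs only
    -- that composition respects sums and products.
    B-equation : B * (1ₛ + C b * X) + C c * X ≋ C a
    B-equation = S.trans
      (S.+-congʳ {C c * X} (S.trans (*-congʳ (1ₛ + C b * X) B≋) (/-cancel {1ₛ + C b * X} p₀ (C a - C c * X))))
      (S+.//-rightDividesˡ (C c * X) (C a))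

    β-equation : β * (1ₛ + C b * f) + C c * f ≋ C a
    β-equation = begin
      β * (1ₛ + C b * f) + C c * f
        ≈⟨ S.+-cong (*-congˡ β (S.+-cong (⟨⟩-C f₀ R.1#) (scaled-X b))) (scaled-X c) ⟨
      β * (1ₛ ⟨ f ⟩ + (C b * X) ⟨ f ⟩) + (C c * X) ⟨ f ⟩
        ≈⟨ S.+-congʳ {(C c * X) ⟨ f ⟩} (*-congˡ β (⟨⟩-+ f₀ 1ₛ (C b * X))) ⟨
      β * (1ₛ + C b * X) ⟨ f ⟩ + (C c * X) ⟨ f ⟩
        ≈⟨ S.+-congʳ {(C c * X) ⟨ f ⟩} (⟨⟩-* f₀ B (1ₛ + C b * X)) ⟨
      (B * (1ₛ + C b * X)) ⟨ f ⟩ + (C c * X) ⟨ f ⟩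
        ≈⟨ ⟨⟩-+ f₀ (B * (1ₛ + C b * X)) (C c * X) ⟨
      (B * (1ₛ + C b * X) + C c * X) ⟨ f ⟩
        ≈⟨ ⟨⟩-cong f₀ B-equation ⟩
      C a ⟨ f ⟩
        ≈⟨ ⟨⟩-C f₀ a ⟩
      C a ∎

  -- The continued fraction over a general ring and its transfer to the complex numbers.

  bSequence⇒continuedFraction : ∀ {a b c g B} → g 0 R.≈ R.1# → IsBSequence g B →
    B ≋ (C a - C c * X) / (1ₛ + C b * X) →
    g IsContinuedFraction[ 1ₛ - C a * X - C b * X ^ 2 , X ^ 2 * (C b + C c * X) ]
  bSequence⇒continuedFraction {a} {b} {c} {g} {B} g₀ isB B≋ =
    quadratic⇒continuedFraction {g} {1ₛ - C a * X - C b * X ^ 2} {X ^ 2 * (C b + C c * X)} d₀ e₀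
      (bSequence⇒quadratic {a} {b} {c} {g} {B} g₀ isB B≋)
    where
    X²-zero : (X ^ 2) 0 R.≈ R.0#
    X²-zero = X*-zero (X ^ 1)

    minus-zero : ∀ {x y} → y R.≈ R.0# → x R.- y R.≈ x
    minus-zero y≈0 = R.trans (R.+-congˡ (R.trans (R.-‿cong y≈0) R+.ε⁻¹≈ε)) (R.+-identityʳ _)

    d₀ : (1ₛ - C a * X - C b * X ^ 2) 0 R.≈ R.1#
    d₀ = R.trans
      (minus-zero (R.trans (C-* b (X ^ 2) 0) (R.trans (R.*-congˡ X²-zero) (R.zeroʳ b))))
      (minus-zero (R.trans (C-* a X 0) (R.zeroʳ a)))

    e₀ : (X ^ 2 * (C b + C c * X)) 0 R.≈ R.0#
    e₀ = *-constant-zero {X ^ 2} X²-zero (C b + C c * X)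

  -- The operations in the hypothesis on `B` and in the conclusion are variables, identified by
  -- matching on `refl` over an arbitrary ring, where no concrete arithmetic can unfold.
  transport-continuedFraction :
    ∀ {_≋′_ : Series → Series → Set ℓ} {C′ : R.Carrier → Series} {X′ 1ₛ′ : Series}
      {_+′_ _-′_ _*′_ _/′_ : Series → Series → Series} {_^′_ : Series → ℕ → Series}
      {cf : Series → Series → Series → Set ℓ} →
    _≋_ ≡ _≋′_ × C ≡ C′ × X ≡ X′ × 1ₛ ≡ 1ₛ′ ×
    _+_ ≡ _+′_ × _-_ ≡ _-′_ × _*_ ≡ _*′_ × _/_ ≡ _/′_ × _^_ ≡ _^′_ ×
    _IsContinuedFraction[_,_] ≡ cf →
    ∀ a b c g B → g 0 R.≈ R.1# → IsBSequence g B →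
    B ≋′ ((C′ a -′ (C′ c *′ X′)) /′ (1ₛ′ +′ (C′ b *′ X′))) →
    cf g ((1ₛ′ -′ (C′ a *′ X′)) -′ (C′ b *′ (X′ ^′ 2))) ((X′ ^′ 2) *′ (C′ b +′ (C′ c *′ X′)))
  transport-continuedFraction
    (refl , refl , refl , refl , refl , refl , refl , refl , refl , refl) a b c g B =
    bSequence⇒continuedFraction {a} {b} {c} {g} {B}

open import Defs

private
  module P = PowerSeries ℂ-commutativeRing

corollary3 : (a b c : ℂ) (g B : Series) →
    IsBellPseudoInvolution g →
    IsBSequence g B →
    B ≋ (C a - C c * X) / (1ₛ + C b * X) →
    g IsContinuedFraction[ 1ₛ - C a * X - C b * X ^ 2 , X ^ 2 * (C b + C c * X) ]
corollary3 a b c g B ((g₀ , _) , _) =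
  PowerSeriesProperties.transport-continuedFraction ℂ-commutativeRing names a b c g B g₀
  where
  -- Comparing two concrete series over the Cauchy reals unfolds their whole
  -- arithmetic, so the names that Defs opens at ℂ are identified with those of
  -- PowerSeries one at a time.
  names : P._≋_ ≡ _≋_ × P.C ≡ C × P.X ≡ X × P.1ₛ ≡ 1ₛ ×
    P._+_ ≡ _+_ × P._-_ ≡ _-_ × P._*_ ≡ _*_ × P._/_ ≡ _/_ × P._^_ ≡ _^_ ×
    P._IsContinuedFraction[_,_] ≡ _IsContinuedFraction[_,_]
  names = refl , refl , refl , refl , refl , refl , refl , refl , refl , refl
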